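{- Let $L$ be a finite loop and let $d\ge 2$ be an integer. Every pair $(\Psi,\Phi)\in\mathcal{C}^2_\delta(L)$ has a unique representation \[(\Psi,\Phi)=(\psi+\delta_f,\ \psi+\nu_f)\quad\text{with } (\psi,f)\in\mathcal{Z}^2(L)\times\mathcal{C}^1(L).\] Moreover, for this representation, \[H_{\psi+\delta_f,\psi+\nu_f,d}[a_1,\ldots,a_d]=H_{\psi,\psi,d}[a_1,\ldots,a_d]\prod_{j=1}^d(-1)^{f(a_j)}\] for all $a_1,\ldots,a_d\in L$. Consequently, the arrays $H_{\psi+\delta_f,\psi+\nu_f,d}$ and $H_{\psi,\psi,d}$ are equivalent under multidimensional Hadamard equivalence.
   Context: A loop is a set $L$ with a binary operation (written by juxtaposition, not necessarily associative) having an identity element $e$ and such that for all $a,b\in L$ the equations $ax=b$ and $ya=b$ have unique solutions $x,y\in L$. $\mathcal{C}^k(L)$ is the set of all functions $L^k\to\mathbb{Z}_2$, with pointwise addition. $\mathcal{Z}^2(L)$ is the set of $2$-cocycles: $\psi\in\mathcal{C}^2(L)$ with $\psi(a,b)+\psi(ab,c)=\psi(a,bc)+\psi(b,c)$ for all $a,b,c\in L$. $\mathcal{C}^2_\delta(L)$ is the set of $\delta$-compatible pairs, i.e. pairs $(\psi,\phi)\in\mathcal{C}^2(L)\times\mathcal{C}^2(L)$ with $\psi(a,b)+\phi(ab,c)=\phi(a,bc)+\psi(b,c)$ for all $a,b,c\in L$. For $f\in\mathcal{C}^1(L)$: $\delta_f(a,b):=f(a)+f(b)+f(ab)$ and $\nu_f(a,b):=f(a)+f(b)$.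 For $\psi\in\mathcal{C}^2(L)$, $M_\psi[a,b]:=(-1)^{\psi(a,b)}$. For $\psi,\phi\in\mathcal{C}^2(L)$ and $d\ge2$, the array $H_{\psi,\phi,d}:L^d\to\{\pm1\}$ is \[H_{\psi,\phi,d}[a_1,\ldots,a_d]:=\left(\prod_{i=2}^{d-1} M_\psi[p_{i-1},a_i]\right)\cdot M_{\phi}[p_{d-1},a_d],\] where $p_1:=a_1$ and $p_i:=p_{i-1}a_i$ for $2\le i<d$ (an empty product is $1$). Two $d$-dimensional $\pm1$ arrays $H,H'$ indexed by $L^d$ are (multidimensionally) Hadamard equivalent if there exist, for each $i\in\{1,\ldots,d\}$, a permutation $\pi_i$ of $L$ and a function $\epsilon_i:L\to\{\pm1\}$ such that $H'[a_1,\ldots,a_d]=\left(\prod_{i=1}^d\epsilon_i(a_i)\right)H[\pi_1(a_1),\ldots,\pi_d(a_d)]$ for all $a_1,\ldots,a_d\in L$. -}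

module Defs where

open import Algebra.Core using (Op₂)
open import Algebra.Structures using (IsLoop)
open import Data.Fin.Base using (Fin; zero; suc; inject₁; fromℕ)
open import Data.Nat.Base using (ℕ; suc; 2+; NonTrivial)
open import Data.Parity.Base using (Parity; toSign; _+_)
open import Data.Product.Base using (Σ-syntax; _×_; _,_)
open import Data.Sign.Base using (Sign; _*_)
open import Data.Sign.Properties using (*-commutativeMonoid)
open import Data.Vec.Functional using (Vector; init; last)
open import Function.Bundles using (_↔_; Inverse)
open import Level using (Level) renaming (suc to lsuc)
open import Relation.Binary.PropositionalEquality.Core using (_≡_)

open import Algebra.Properties.CommutativeMonoid.Sum *-commutativeMonoid
  public using () renaming (sum to ∏)

-- The unique solutions of a x = b and y a = b are x = a \\ b and y = b // a.
record FiniteLoop (ℓ : Level) : Set (lsuc ℓ) where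
  infixl 7 _∙_ _\\_ _//_
  field
    Carrier : Set ℓ
    _∙_     : Op₂ Carrier
    _\\_    : Op₂ Carrier
    _//_    : Op₂ Carrier
    e       : Carrier
    isLoop  : IsLoop _≡_ _∙_ _\\_ _//_ e
    order   : ℕ
    finite  : Carrier ↔ Fin order

-- ℤ₂ is Parity and {±1} is Sign.
module LoopCochains {ℓ : Level} (L : FiniteLoop ℓ) where
  open FiniteLoop L

  𝒞¹ : Set ℓ
  𝒞¹ = Carrier → Parity

  𝒞² : Set ℓ
  𝒞² = Carrier → Carrier → Parity

  infixl 6 _⊕_
  _⊕_ : 𝒞² → 𝒞² → 𝒞²
  (ψ ⊕ φ) a b = ψ a b + φ a b

  infix 4 _≈¹_ _≈²_
  _≈¹_ : 𝒞¹ → 𝒞¹ → Set ℓ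
  f ≈¹ g = ∀ a → f a ≡ g a

  _≈²_ : 𝒞² → 𝒞² → Set ℓ
  ψ ≈² φ = ∀ a b → ψ a b ≡ φ a b

  IsCocycle : 𝒞² → Set ℓ
  IsCocycle ψ = ∀ a b c →
    ψ a b + ψ (a ∙ b) c ≡ ψ a (b ∙ c) + ψ b c

  δ-Compatible : 𝒞² → 𝒞² → Set ℓ
  δ-Compatible ψ φ = ∀ a b c →
    ψ a b + φ (a ∙ b) c ≡ φ a (b ∙ c) + ψ b c

  δ : 𝒞¹ → 𝒞²
  δ f a b = f a + f b + f (a ∙ b)

  ν : 𝒞¹ → 𝒞²
  ν f a b = f a + f b

  Represents : 𝒞² → 𝒞² → 𝒞² × 𝒞¹ → Set ℓ
  Represents Ψ Φ (ψ , f) =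
    IsCocycle ψ × (Ψ ≈² ψ ⊕ δ f) × (Φ ≈² ψ ⊕ ν f)

  infix 4 _≈_
  _≈_ : 𝒞² × 𝒞¹ → 𝒞² × 𝒞¹ → Set ℓ
  (ψ , f) ≈ (ψ′ , f′) = (ψ ≈² ψ′) × (f ≈¹ f′)

  -- toSign p is (-1)^p.
  M : 𝒞² → Carrier → Carrier → Sign
  M ψ a b = toSign (ψ a b)

  Array : ℕ → Set ℓ
  Array d = Vector Carrier d → Sign

  -- The left-normed products a₁, a₁a₂, (a₁a₂)a₃, …
  prefixProducts : ∀ {n} → Vector Carrier n → Vector Carrier n
  prefixProducts {suc n}  a zero    = a zero
  prefixProducts {2+ n}   a (suc i) = prefixProducts (init a) i ∙ a (suc i)

  -- For d = 2+ m, the index i : Fin m of the product stands for i + 2 in the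
  -- range 2, …, d-1, since Fin counts from 0; p is (p₁, …, p_{d-1}).
  H : 𝒞² → 𝒞² → (d : ℕ) .{{_ : NonTrivial d}} → Array d
  H ψ φ (2+ m) a =
    ∏ {m} (λ i → M ψ (p (inject₁ i)) (a (inject₁ (suc i)))) * M φ (last p) (last a)
    where
    p : Vector Carrier (suc m)
    p = prefixProducts (init a)

  HadamardEquivalent : ∀ {d} → Array d → Array d → Set ℓ
  HadamardEquivalent {d} A A′ =
    Σ[ π ∈ (Fin d → Carrier ↔ Carrier) ]
    Σ[ ε ∈ (Fin d → Carrier → Sign) ]
      (∀ a → A′ a ≡ ∏ (λ i → ε i (a i)) * A (λ i → Inverse.to (π i) (a i)))

{-# OPTIONS --safe #-}

-- Setting one entry of (a, b, c) to e in δ-compatibility shows that Ψ(x, e) and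
-- Ψ(e, y) are one common constant, and then that Ψ(a, b) + Φ(a, b) depends on
-- ab only: it is f(ab) for f(x) = Ψ(e, x) + Φ(e, x). As δ_f(a, b) + ν_f(a, b) is
-- f(ab), this f is the only candidate, and ψ = Ψ + δ_f is then forced.
-- In the array the factors (-1)^δ_f(p_{i-1}, a_i) telescope, because
-- δ_f(p_{i-1}, a_i) = f(p_{i-1}) + f(a_i) + f(p_i), and ν_f in the last factor
-- cancels the remaining f(p_{d-1}).
module Submission where

open import Defs
open import Algebra.Structures using (module IsLoop)
open import Data.Fin.Base using (Fin; zero; suc; inject₁; fromℕ)
open import Data.Maybe.Base using (just; nothing)
open import Data.Nat.Base using (ℕ; suc; 2+; NonTrivial)
open import Data.Parity.Base using (0ℙ; 1ℙ; toSign; _+_)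
open import Data.Parity.Properties
  using (+-*-commutativeRing; +-cancelʳ-≡; +-homo-*)
open import Data.Product using (∃!; _×_; _,_)
open import Data.Sign.Base using (Sign; _*_)
open import Data.Sign.Properties
  using (*-assoc; *-identityʳ; *-comm; s*s≡+; *-commutativeMonoid;
         *-commutativeSemigroup)
open import Data.Vec.Functional using (Vector; init; last)
open import Function.Base using (_∘_)
open import Function.Construct.Identity using (↔-id)
open import Relation.Binary.PropositionalEquality.Core
  using (_≡_; refl; sym; trans; cong; cong₂; subst)
open import Relation.Binary.PropositionalEquality.Properties
  using (module ≡-Reasoning)
open import Tactic.RingSolver using (solve-∀)
open import Tactic.RingSolver.Core.AlmostCommutativeRing
  using (AlmostCommutativeRing; fromCommutativeRing)

open import Algebra.Properties.CommutativeMonoid.Sum *-commutativeMonoid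
  using (sum-cong-≗; sum-init-last; ∑-distrib-+)
open import Algebra.Properties.CommutativeSemigroup *-commutativeSemigroup
  using (interchange)

open ≡-Reasoning

-- Recognising 1 + 1 as the zero coefficient lets the solver use characteristic 2.
ℤ₂-ring : AlmostCommutativeRing _ _
ℤ₂-ring = fromCommutativeRing +-*-commutativeRing
  λ { 0ℙ → just refl ; 1ℙ → nothing }

-- In characteristic 2 a term changes sides without a sign: `p + s` is added to both sides.
+-transpose : ∀ p q r s → p + q ≡ r + s → s + q ≡ r + p
+-transpose p q r s eq = begin
  s + q           ≡⟨ expand p q s ⟩
  (p + q) + p + s ≡⟨ cong (λ t → t + p + s) eq ⟩
  (r + s) + p + s ≡⟨ collapse p r s ⟩
  r + p           ∎
  where
  expand : ∀ p q s → s + q ≡ (p + q) + p + s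
  expand = solve-∀ ℤ₂-ring
  collapse : ∀ p r s → (r + s) + p + s ≡ r + p
  collapse = solve-∀ ℤ₂-ring

+-move : ∀ p q r → p + q ≡ r → q ≡ p + r
+-move p q _ refl = expand p q
  where
  expand : ∀ p q → q ≡ p + (p + q)
  expand = solve-∀ ℤ₂-ring

module _ {ℓ} (L : FiniteLoop ℓ) where
  open FiniteLoop L
  open LoopCochains L
  open IsLoop isLoop using (identityˡ; identityʳ)

  module _ (Ψ Φ : 𝒞²) (compatible : δ-Compatible Ψ Φ) where

    -- With the middle entry equal to `e`, both `Φ` terms become `Φ x y` and cancel. Since `x` and
    -- `y` vary independently, both sides are one constant.
    compatible⇒const : ∀ x y → Ψ x e ≡ Ψ e y
    compatible⇒const x y = +-cancelʳ-≡ (Φ x y) (Ψ x e) (Ψ e y) (begin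
      Ψ x e + Φ x y       ≡⟨ cong (λ z → Ψ x e + Φ z y) (identityʳ x) ⟨
      Ψ x e + Φ (x ∙ e) y ≡⟨ compatible x e y ⟩
      Φ x (e ∙ y) + Ψ e y ≡⟨ cong (λ z → Φ x z + Ψ e y) (identityˡ y) ⟩
      Φ x y + Ψ e y       ≡⟨ comm (Φ x y) (Ψ e y) ⟩
      Ψ e y + Φ x y       ∎)
      where
      comm : ∀ p q → p + q ≡ q + p
      comm = solve-∀ ℤ₂-ring

    difference : 𝒞¹
    difference x = Φ e x + Ψ e x

    Ψ+Φ≡difference : ∀ a b → Ψ a b + Φ a b ≡ difference (a ∙ b)
    Ψ+Φ≡difference a b = begin
      Ψ a b + Φ a b             ≡⟨ +-transpose (Ψ e a) (Φ a b) (Φ e (a ∙ b)) (Ψ a b) (begin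
        Ψ e a + Φ a b             ≡⟨ cong (λ z → Ψ e a + Φ z b) (identityˡ a) ⟨
        Ψ e a + Φ (e ∙ a) b       ≡⟨ compatible e a b ⟩
        Φ e (a ∙ b) + Ψ a b       ∎) ⟩
      -- `Ψ e a` and `Ψ e (a ∙ b)` both equal `Ψ e e`.
      Φ e (a ∙ b) + Ψ e a       ≡⟨ cong (Φ e (a ∙ b) +_)
                                     (trans (sym (compatible⇒const e a))
                                            (compatible⇒const e (a ∙ b))) ⟩
      Φ e (a ∙ b) + Ψ e (a ∙ b) ∎

    Φ≡Ψ+difference : ∀ a b → Φ a b ≡ Ψ a b + difference (a ∙ b)
    Φ≡Ψ+difference a b = +-move (Ψ a b) (Φ a b) _ (Ψ+Φ≡difference a b)

    -- As `L` may be non-associative, `δ f` alone need not be a cocycle: its two sides leave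
    -- `f (a ∙ b ∙ c)` and `f (a ∙ (b ∙ c))`. These leftovers are what turns `Ψ (a ∙ b) c` and
    -- `Ψ a (b ∙ c)` into the `Φ` terms of compatibility.
    Ψ+δ-isCocycle : IsCocycle (Ψ ⊕ δ difference)
    Ψ+δ-isCocycle a b c = begin
      (Ψ ⊕ δ f) a b + (Ψ ⊕ δ f) (a ∙ b) c
        ≡⟨ regroupˡ (Ψ a b) (Ψ (a ∙ b) c) (f a) (f b) (f c) (f (a ∙ b)) (f (a ∙ b ∙ c)) ⟩
      Ψ a b + (Ψ (a ∙ b) c + f (a ∙ b ∙ c)) + (f a + f b + f c)
        ≡⟨ cong (λ t → Ψ a b + t + (f a + f b + f c)) (Φ≡Ψ+difference (a ∙ b) c) ⟨
      Ψ a b + Φ (a ∙ b) c + (f a + f b + f c)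
        ≡⟨ cong (_+ (f a + f b + f c)) (compatible a b c) ⟩
      Φ a (b ∙ c) + Ψ b c + (f a + f b + f c)
        ≡⟨ cong (λ t → t + Ψ b c + (f a + f b + f c)) (Φ≡Ψ+difference a (b ∙ c)) ⟩
      (Ψ a (b ∙ c) + f (a ∙ (b ∙ c))) + Ψ b c + (f a + f b + f c)
        ≡⟨ regroupʳ (Ψ a (b ∙ c)) (Ψ b c) (f a) (f b) (f c) (f (b ∙ c)) (f (a ∙ (b ∙ c))) ⟩
      (Ψ ⊕ δ f) a (b ∙ c) + (Ψ ⊕ δ f) b c ∎
      where
      f = difference
      regroupˡ : ∀ p q x y z u v →
        (p + (x + y + u)) + (q + (u + z + v)) ≡ p + (q + v) + (x + y + z)
      regroupˡ = solve-∀ ℤ₂-ring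
      regroupʳ : ∀ p q x y z u v →
        (p + v) + q + (x + y + z) ≡ (p + (x + u + v)) + (q + (y + z + u))
      regroupʳ = solve-∀ ℤ₂-ring

    compatible⇒represents : Represents Ψ Φ (Ψ ⊕ δ difference , difference)
    compatible⇒represents
      = Ψ+δ-isCocycle
      , (λ a b → cancel-δ (Ψ a b) (δ difference a b))
      , (λ a b → trans (Φ≡Ψ+difference a b)
          (split (Ψ a b) (difference a) (difference b) (difference (a ∙ b))))
      where
      cancel-δ : ∀ p q → p ≡ (p + q) + q
      cancel-δ = solve-∀ ℤ₂-ring
      split : ∀ p x y z → p + z ≡ (p + (x + y + z)) + (x + y)
      split = solve-∀ ℤ₂-ring

  represents⇒sum : ∀ {Ψ Φ} ψ f → Represents Ψ Φ (ψ , f) →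
                   ∀ a b → Ψ a b + Φ a b ≡ f (a ∙ b)
  represents⇒sum ψ f (_ , Ψ≈ , Φ≈) a b =
    trans (cong₂ _+_ (Ψ≈ a b) (Φ≈ a b))
          (collapse (ψ a b) (f a) (f b) (f (a ∙ b)))
    where
    collapse : ∀ p x y z → (p + (x + y + z)) + (p + (x + y)) ≡ z
    collapse = solve-∀ ℤ₂-ring

  represents-unique : ∀ {Ψ Φ} s t →
                      Represents Ψ Φ s → Represents Ψ Φ t → s ≈ t
  represents-unique {Ψ} (ψ , f) (ψ′ , f′) r@(_ , Ψ≈ , _) r′@(_ , Ψ≈′ , _)
    = ψ≈ψ′ , f≈f′
    where
    f≈f′ : f ≈¹ f′
    -- Writing `x` as `e ∙ x` makes every value of `f` visible in the sum of the pair.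
    f≈f′ x = subst (λ z → f z ≡ f′ z) (identityˡ x)
      (trans (sym (represents⇒sum ψ f r e x)) (represents⇒sum ψ′ f′ r′ e x))

    δ≈δ′ : δ f ≈² δ f′
    δ≈δ′ a b = cong₂ _+_ (cong₂ _+_ (f≈f′ a) (f≈f′ b)) (f≈f′ (a ∙ b))

    ψ≈ψ′ : ψ ≈² ψ′
    ψ≈ψ′ a b = +-cancelʳ-≡ (δ f a b) (ψ a b) (ψ′ a b) (begin
      ψ a b + δ f a b   ≡⟨ Ψ≈ a b ⟨
      Ψ a b             ≡⟨ Ψ≈′ a b ⟩
      ψ′ a b + δ f′ a b ≡⟨ cong (ψ′ a b +_) (δ≈δ′ a b) ⟨
      ψ′ a b + δ f a b  ∎)

  compatible⇒∃!-represents : ∀ Ψ Φ → δ-Compatible Ψ Φ → ∃! _≈_ (Represents Ψ Φ)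
  compatible⇒∃!-represents Ψ Φ compatible
    = s , represents , λ {t} → represents-unique s t represents
    where
    f = difference Ψ Φ compatible
    s = Ψ ⊕ δ f , f
    represents = compatible⇒represents Ψ Φ compatible

  -- Inductions on length split off the last entry and need the earlier prefixes of `a` to be those
  -- of `init a`. The recursion passes through `init`, so this is not definitional.
  prefixProducts-init : ∀ {n} (a : Vector Carrier (suc n)) (i : Fin n) →
    prefixProducts a (inject₁ i) ≡ prefixProducts (init a) i
  prefixProducts-init        a zero    = refl
  prefixProducts-init {2+ n} a (suc i) =
    cong (_∙ a (inject₁ (suc i))) (prefixProducts-init (init a) i)

  module _ (f : 𝒞¹) where

    sgn : Carrier → Sign
    sgn x = toSign (f x)

    toSign-δ-cancel : ∀ x y → toSign (δ f x y) * sgn (x ∙ y) ≡ sgn x * sgn y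
    toSign-δ-cancel x y = begin
      toSign (δ f x y) * sgn (x ∙ y)     ≡⟨ +-homo-* (δ f x y) (f (x ∙ y)) ⟨
      toSign (δ f x y + f (x ∙ y))       ≡⟨ cong toSign (cancel (f x) (f y) (f (x ∙ y))) ⟩
      toSign (f x + f y)                 ≡⟨ +-homo-* (f x) (f y) ⟩
      sgn x * sgn y                      ∎
      where
      cancel : ∀ p q r → (p + q + r) + r ≡ p + q
      cancel = solve-∀ ℤ₂-ring

    -- Counting from 1, entry `i` belongs to the pair of the prefix product ending at position
    -- `i + 1` and the element at position `i + 2`.
    δ-factor : ∀ {m} → Vector Carrier (suc m) → Vector Sign m
    δ-factor a i = toSign (δ f (prefixProducts a (inject₁ i)) (a (suc i)))

    δ-factor-init : ∀ {m} (a : Vector Carrier (2+ m)) i →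
                    init (δ-factor a) i ≡ δ-factor (init a) i
    δ-factor-init a i =
      cong (λ z → toSign (δ f z (a (suc (inject₁ i)))))
           (prefixProducts-init a (inject₁ i))

    -- The sign of the last prefix product is the boundary term of the telescope. Keeping it on the
    -- left closes the induction: the next factor trades it for the signs of the shorter prefix and
    -- of the new entry.
    ∏-δ-telescope : ∀ {m} (a : Vector Carrier (suc m)) →
      ∏ (δ-factor a) * sgn (last (prefixProducts a)) ≡ ∏ (sgn ∘ a)
    ∏-δ-telescope {0}     a = sym (*-identityʳ (sgn (a zero)))
    ∏-δ-telescope {suc m} a = begin
      -- `last (prefixProducts a)` unfolds to `x ∙ y`.
      ∏ (δ-factor a) * sgn (x ∙ y)
        ≡⟨ cong (_* sgn (x ∙ y)) (sum-init-last (δ-factor a)) ⟩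
      (∏ (init (δ-factor a)) * last (δ-factor a)) * sgn (x ∙ y)
        ≡⟨ cong₂ (λ s z → (s * toSign (δ f z y)) * sgn (x ∙ y))
                 (sum-cong-≗ (δ-factor-init a)) (prefixProducts-init a (fromℕ m)) ⟩
      (∏ (δ-factor (init a)) * toSign (δ f x y)) * sgn (x ∙ y)
        ≡⟨ *-assoc (∏ (δ-factor (init a))) _ _ ⟩
      ∏ (δ-factor (init a)) * (toSign (δ f x y) * sgn (x ∙ y))
        ≡⟨ cong (∏ (δ-factor (init a)) *_) (toSign-δ-cancel x y) ⟩
      ∏ (δ-factor (init a)) * (sgn x * sgn y)
        ≡⟨ *-assoc (∏ (δ-factor (init a))) _ _ ⟨
      (∏ (δ-factor (init a)) * sgn x) * sgn y
        ≡⟨ cong (_* sgn y) (∏-δ-telescope (init a)) ⟩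
      ∏ (sgn ∘ init a) * sgn y
        ≡⟨ sum-init-last (sgn ∘ a) ⟨
      ∏ (sgn ∘ a) ∎
      where
      x = last (prefixProducts (init a))
      y = last a

    H-δ-ν : ∀ (ψ : 𝒞²) d .{{_ : NonTrivial d}} (a : Vector Carrier d) →
            H (ψ ⊕ δ f) (ψ ⊕ ν f) d a ≡ H ψ ψ d a * ∏ (sgn ∘ a)
    H-δ-ν ψ (2+ m) a = begin
      ∏ (λ i → toSign (ψ (q i) (b i) + δ f (q i) (b i))) * toSign (ψ x y + ν f x y)
        ≡⟨ cong₂ _*_
             (trans (sum-cong-≗ (λ i → +-homo-* (ψ (q i) (b i)) (δ f (q i) (b i))))
                    (∑-distrib-+ (λ i → M ψ (q i) (b i)) (δ-factor (init a))))
             (trans (+-homo-* (ψ x y) (ν f x y))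
                    (cong (M ψ x y *_) (+-homo-* (f x) (f y)))) ⟩
      (∏ψ * ∏δ) * (M ψ x y * (sgn x * sgn y))
        ≡⟨ interchange ∏ψ ∏δ (M ψ x y) (sgn x * sgn y) ⟩
      (∏ψ * M ψ x y) * (∏δ * (sgn x * sgn y))
        -- From the `ν` factor, `sgn x` is the boundary term for telescoping over `init a`, and
        -- `sgn y` is the sign of the last entry.
        ≡⟨ cong ((∏ψ * M ψ x y) *_) (begin
             ∏δ * (sgn x * sgn y)     ≡⟨ *-assoc ∏δ (sgn x) (sgn y) ⟨
             (∏δ * sgn x) * sgn y     ≡⟨ cong (_* sgn y) (∏-δ-telescope (init a)) ⟩
             ∏ (sgn ∘ init a) * sgn y ≡⟨ sum-init-last (sgn ∘ a) ⟨
             ∏ (sgn ∘ a)              ∎) ⟩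
      (∏ψ * M ψ x y) * ∏ (sgn ∘ a) ∎
      where
      q b : Vector Carrier m
      q i = prefixProducts (init a) (inject₁ i)
      b i = init a (suc i)
      x   = last (prefixProducts (init a))
      y   = last a
      ∏ψ  = ∏ (λ i → M ψ (q i) (b i))
      ∏δ  = ∏ (δ-factor (init a))

  -- Identity permutations suffice. A sign is its own inverse, so the same `ε` in every coordinate
  -- also carries `A` back to `A′`.
  scaled⇒HadamardEquivalent : ∀ {d} {A A′ : Array d} (ε : Carrier → Sign) →
    (∀ a → A a ≡ A′ a * ∏ (ε ∘ a)) → HadamardEquivalent A A′
  scaled⇒HadamardEquivalent {A = A} {A′} ε scaled =
    (λ _ → ↔-id Carrier) , (λ _ → ε) , λ a → begin
      A′ a                            ≡⟨ *-identityʳ (A′ a) ⟨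
      A′ a * Sign.+                   ≡⟨ cong (A′ a *_) (s*s≡+ (∏ (ε ∘ a))) ⟨
      A′ a * (∏ (ε ∘ a) * ∏ (ε ∘ a))  ≡⟨ *-assoc (A′ a) _ _ ⟨
      (A′ a * ∏ (ε ∘ a)) * ∏ (ε ∘ a)  ≡⟨ cong (_* ∏ (ε ∘ a)) (scaled a) ⟨
      A a * ∏ (ε ∘ a)                 ≡⟨ *-comm (A a) _ ⟩
      ∏ (ε ∘ a) * A a                 ∎

mainTheorem3 : ∀ {ℓ} (L : FiniteLoop ℓ) (d : ℕ) .{{_ : NonTrivial d}} →
    let open LoopCochains L in
    ∀ (Ψ Φ : 𝒞²) → δ-Compatible Ψ Φ →
    ∃! _≈_ (Represents Ψ Φ)
    × (∀ (ψ : 𝒞²) (f : 𝒞¹) → Represents Ψ Φ (ψ , f) →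
    (∀ a → H (ψ ⊕ δ f) (ψ ⊕ ν f) d a ≡ H ψ ψ d a * ∏ (λ j → toSign (f (a j))))
    × HadamardEquivalent (H (ψ ⊕ δ f) (ψ ⊕ ν f) d) (H ψ ψ d))
mainTheorem3 L d Ψ Φ compatible
  = compatible⇒∃!-represents L Ψ Φ compatible
  , λ ψ f _ → H-δ-ν L f ψ d
            , scaled⇒HadamardEquivalent L (toSign ∘ f) (H-δ-ν L f ψ d)
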